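{- The following problem is in $\mathsf{AC}^0$. Input: a binary number $A=(a_0,\ldots,a_{m-1})$ with $a_i\in\{0,1\}$, representing $\sum_{i=0}^{m-1}a_i2^i$. Output: a compact signed-digit representation of $A$, i.e. a compact signed-digit representation $B$ with $\mathrm{val}(B)=\sum_{i=0}^{m-1}a_i2^i$.
   Context: A signed-digit representation is a sequence $B=(b_0,\ldots,b_{m-1})$ with $b_i\in\{ -1,0,1\}$; its value is $\mathrm{val}(B)=\sum_{i=0}^{m-1}b_i2^i\in\mathbb{Z}$. It is compact if $b_ib_{i-1}=0$ for all $i\in\{1,\ldots,m-1\}$ (no two successive digits are non-zero). The three digit values $-1,0,1$ are each encoded using two bits. $\mathsf{AC}^0$ is the (non-uniform) class of functions computed by families of polynomial-size, constant-depth circuits with unbounded fan-in And, Or and Not gates. -}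

module Defs where

open import Data.Bool.Base using (Bool; not; if_then_else_)
open import Data.Bool.ListAction using (all; any)
open import Data.Fin.Base using (Fin; toℕ)
open import Data.Integer.Base using (ℤ; 0ℤ; 1ℤ; -1ℤ; +_; _*_; _^_)
open import Data.Integer.Properties using (+-0-monoid)
open import Data.List.Base using (List)
import Data.List.Base as List
open import Data.List.Extrema.Nat using (max)
open import Data.Nat.Base as ℕ using (ℕ; suc; _≤_)
open import Data.Product.Base using (∃-syntax)
open import Data.Vec.Base using (Vec; _∷_; lookup; map; concat; replicate; toList)
open import Function.Definitions using (Injective)
open import Relation.Binary.PropositionalEquality using (_≡_)

open import Algebra.Properties.Monoid.Sum +-0-monoid using (sum)

------------------------------------------------------------------------
-- Binary numbers and signed-digit representations
-- (index 0 is the least significant position)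

weightedSum : ∀ {m} → Vec ℤ m → ℤ
weightedSum xs = sum λ i → lookup xs i * (+ 2) ^ toℕ i

bit→ℤ : Bool → ℤ
bit→ℤ b = if b then 1ℤ else 0ℤ

binaryValue : ∀ {m} → Vec Bool m → ℤ
binaryValue a = weightedSum (map bit→ℤ a)

data Digit : Set where
  minusOne nought plusOne : Digit

digit→ℤ : Digit → ℤ
digit→ℤ minusOne = -1ℤ
digit→ℤ nought   = 0ℤ
digit→ℤ plusOne  = 1ℤ

val : ∀ {m} → Vec Digit m → ℤ
val b = weightedSum (map digit→ℤ b)

Compact : ∀ {m} → Vec Digit m → Set
Compact {m} b = ∀ (i j : Fin m) → toℕ i ≡ suc (toℕ j) →
  digit→ℤ (lookup b i) * digit→ℤ (lookup b j) ≡ 0ℤ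

record DigitEncoding : Set where
  field
    code      : Digit → Vec Bool 2
    injective : Injective _≡_ _≡_ code

encode : DigitEncoding → ∀ {m} → Vec Digit m → Vec Bool (m ℕ.* 2)
encode e b = concat (map (DigitEncoding.code e) b)

------------------------------------------------------------------------
-- Circuits with unbounded fan-in

-- A gate reading from k available nodes.  A list may repeat a node; this
-- does not affect the value of the gate.  The empty conjunction and
-- disjunction are the constants true and false.
data Gate (k : ℕ) : Set where
  And Or : List (Fin k) → Gate k
  Not    : Fin k → Gate k

infixl 5 _▷_

-- Topologically sorted acyclic circuits with n inputs and s gates: each
-- gate reads inputs and earlier gates only.  Among the s + n nodes, the
-- most recent gate has index zero and the inputs have the last n indices.
data Gates (n : ℕ) : ℕ → Set where
  []  : Gates n 0
  _▷_ : ∀ {s} → Gates n s → Gate (s ℕ.+ n) → Gates n (suc s)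

evalGate : ∀ {k} → Vec Bool k → Gate k → Bool
evalGate ρ (And is) = all (lookup ρ) is
evalGate ρ (Or is)  = any (lookup ρ) is
evalGate ρ (Not i)  = not (lookup ρ i)

evalGates : ∀ {n s} → Gates n s → Vec Bool n → Vec Bool (s ℕ.+ n)
evalGates []       x = x
evalGates (gs ▷ g) x = let ρ = evalGates gs x in evalGate ρ g ∷ ρ

gateDepth : ∀ {k} → Vec ℕ k → Gate k → ℕ
gateDepth δ (And is) = suc (max 0 (List.map (lookup δ) is))
gateDepth δ (Or is)  = suc (max 0 (List.map (lookup δ) is))
gateDepth δ (Not i)  = suc (lookup δ i)

nodeDepths : ∀ {n s} → Gates n s → Vec ℕ (s ℕ.+ n)
nodeDepths {n} []   = replicate n 0
nodeDepths (gs ▷ g) = let δ = nodeDepths gs in gateDepth δ g ∷ δ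

record Circuit (n o : ℕ) : Set where
  field
    {gateCount} : ℕ
    gates       : Gates n gateCount
    outputs     : Vec (Fin (gateCount ℕ.+ n)) o

eval : ∀ {n o} → Circuit n o → Vec Bool n → Vec Bool o
eval C x = map (lookup (evalGates gates x)) outputs
  where open Circuit C

depth : ∀ {n o} → Circuit n o → ℕ
depth C = max 0 (toList (nodeDepths (Circuit.gates C)))

-- Inputs, gates and outputs all count as vertices; in particular a circuit
-- of polynomial size has polynomially many outputs.
size : ∀ {n o} → Circuit n o → ℕ
size {n} {o} C = n ℕ.+ Circuit.gateCount C ℕ.+ o

------------------------------------------------------------------------
-- Non-uniform AC⁰, as a class of functions on bit strings whose output
-- length depends only on the input length

record InAC⁰ {ℓ : ℕ → ℕ} (f : ∀ m → Vec Bool m → Vec Bool (ℓ m)) : Set where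
  field
    circuit       : ∀ m → Circuit m (ℓ m)
    computes      : ∀ m (x : Vec Bool m) → eval (circuit m) x ≡ f m x
    constantDepth : ∃[ d ] ∀ m → depth (circuit m) ≤ d
    polySize      : ∃[ c ] ∃[ k ] ∀ m → size (circuit m) ≤ c ℕ.* m ℕ.^ k ℕ.+ c

{-# OPTIONS --safe #-}
module Submission where

-- Let c₀ = 0 and let cᵢ₊₁ be the majority of aᵢ, aᵢ₊₁ and cᵢ.  The digits
-- bᵢ = aᵢ + cᵢ − 2cᵢ₊₁ have value Σ aᵢ2ⁱ because the carries telescope.
-- They are compact: bᵢ ≠ 0 forces aᵢ ≠ cᵢ, so the majority cᵢ₊₁ equals aᵢ₊₁
-- and bᵢ₊₁ = 0.  Carry lookahead turns cᵢ into an or of ands of bounded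
-- depth.  A formula of constant depth and fan-in linear in m has polynomial
-- size, so it can be compiled to a circuit without sharing any gates.

open import Data.Bool.Base
  using (Bool; true; false; not; _∧_; _∨_; _xor_; if_then_else_)
open import Data.Bool.ListAction using (all; any)
open import Data.Bool.Properties
  using (∧-assoc; ∧-comm; ∧-zeroʳ; ∧-distribˡ-∨; ∧-identityʳ; ∨-identityʳ)
open import Data.Fin.Base using (Fin; zero; suc; toℕ; fromℕ<)
open import Data.Fin.Properties using (toℕ<n)
open import Data.Integer.Base as ℤ using (ℤ; 0ℤ; +_)
import Data.Integer.Properties as ℤ
import Data.Integer.Tactic.RingSolver as ℤ
import Data.List.Base as List
open import Data.List.Extrema.Nat using (max; max≤v⁺)
import Data.List.Relation.Unary.All.Properties as List
open import Data.List.Properties using (map-tabulate)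
import Data.List.Relation.Unary.All as List using (All)
open import Data.Nat.Base
  using (ℕ; zero; suc; _+_; _*_; _^_; _∸_; _≤_; _<_; z≤n; s≤s; s≤s⁻¹)
open import Data.Nat.Properties
open import Data.Nat.Tactic.RingSolver using (solve-∀)
open import Data.Product.Base using (_×_; Σ-syntax; _,_)
open import Data.Vec.Base
  using (Vec; []; _∷_; lookup; map; concat; tabulate; toList)
open import Data.Vec.Functional using (foldr)
open import Data.Vec.Properties
  using (lookup∘tabulate; tabulate∘lookup; tabulate-∘; tabulate-cong;
         lookup-map; lookup-replicate; map-concat)
open import Data.Vec.Relation.Unary.All.Properties using (lookup⁻; toList⁺)
open import Function.Base using (_∘_)
open import Relation.Binary.PropositionalEquality
  using (_≡_; _≗_; refl; sym; trans; cong; cong₂; subst; module ≡-Reasoning)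
open import Relation.Nullary.Decidable.Core using (yes; no)
open import Defs

open import Algebra.Properties.CommutativeMonoid.Sum ℤ.+-0-commutativeMonoid
  using (sum; sum-cong-≗; ∑-distrib-+)

private
  variable
    d k m n s s′ s″ w N : ℕ

-- Finite conjunctions and disjunctions

⋀ ⋁ : (Fin k → Bool) → Bool
⋀ = foldr _∧_ true
⋁ = foldr _∨_ false

⋀-cong : {p q : Fin k → Bool} → p ≗ q → ⋀ p ≡ ⋀ q
⋀-cong {zero}  p≗q = refl
⋀-cong {suc k} p≗q = cong₂ _∧_ (p≗q zero) (⋀-cong (p≗q ∘ suc))

⋁-cong : {p q : Fin k → Bool} → p ≗ q → ⋁ p ≡ ⋁ q
⋁-cong {zero}  p≗q = refl
⋁-cong {suc k} p≗q = cong₂ _∨_ (p≗q zero) (⋁-cong (p≗q ∘ suc))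

∧-distribˡ-⋁ : ∀ b (p : Fin k → Bool) → b ∧ ⋁ p ≡ ⋁ λ i → b ∧ p i
∧-distribˡ-⋁ {zero}  b p = ∧-zeroʳ b
∧-distribˡ-⋁ {suc k} b p =
  trans (∧-distribˡ-∨ b _ _) (cong (b ∧ p zero ∨_) (∧-distribˡ-⋁ b (p ∘ suc)))

all-tabulate : ∀ {A : Set} (p : A → Bool) (f : Fin k → A) →
  all p (List.tabulate f) ≡ ⋀ (p ∘ f)
all-tabulate {zero}  p f = refl
all-tabulate {suc k} p f = cong (_ ∧_) (all-tabulate p (f ∘ suc))

any-tabulate : ∀ {A : Set} (p : A → Bool) (f : Fin k → A) →
  any p (List.tabulate f) ≡ ⋁ (p ∘ f)
any-tabulate {zero}  p f = refl
any-tabulate {suc k} p f = cong (_ ∨_) (any-tabulate p (f ∘ suc))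

-- Formulas of bounded depth and fan-in

data Formula (n w : ℕ) : ℕ → Set where
  var     : Fin n → Formula n w d
  lift    : Formula n w d → Formula n w (suc d)
  neg     : Formula n w d → Formula n w (suc d)
  and or  : k ≤ w → (Fin k → Formula n w d) → Formula n w (suc d)

⟦_⟧ : Formula n w d → Vec Bool n → Bool
⟦ var i ⟧ x    = lookup x i
⟦ lift f ⟧ x   = ⟦ f ⟧ x
⟦ neg f ⟧ x    = not (⟦ f ⟧ x)
⟦ and _ fs ⟧ x = ⋀ λ i → ⟦ fs i ⟧ x
⟦ or _ fs ⟧ x  = ⋁ λ i → ⟦ fs i ⟧ x

-- Compiling formulas to circuits

infix 4 _⊑[_]_

-- `depth` takes the maximum over all nodes, even those that no output reads, so the bound is
-- imposed on every added gate.
data _⊑[_]_ (gs : Gates n s) (d : ℕ) : Gates n s′ → Set where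
  done : gs ⊑[ d ] gs
  snoc : {gs′ : Gates n s′} {g : Gate (s′ + n)} →
         gs ⊑[ d ] gs′ → gateDepth (nodeDepths gs′) g ≤ d → gs ⊑[ d ] gs′ ▷ g

⊑-trans : {gs : Gates n s} {gs′ : Gates n s′} {gs″ : Gates n s″} →
  gs ⊑[ d ] gs′ → gs′ ⊑[ d ] gs″ → gs ⊑[ d ] gs″
⊑-trans p done       = p
⊑-trans p (snoc q r) = snoc (⊑-trans p q) r

⊑-suc : {gs : Gates n s} {gs′ : Gates n s′} → gs ⊑[ d ] gs′ → gs ⊑[ suc d ] gs′
⊑-suc done       = done
⊑-suc (snoc p r) = snoc (⊑-suc p) (m≤n⇒m≤1+n r)

⊑-depths : {gs : Gates n s} → [] ⊑[ d ] gs → ∀ i → lookup (nodeDepths gs) i ≤ d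
⊑-depths done       i       = ≤-trans (≤-reflexive (lookup-replicate i 0)) z≤n
⊑-depths (snoc p r) zero    = r
⊑-depths (snoc p r) (suc i) = ⊑-depths p i

record Node (gs : Gates n s) (d : ℕ) (h : Vec Bool n → Bool) : Set where
  field
    index  : Fin (s + n)
    value  : ∀ x → lookup (evalGates gs x) index ≡ h x
    depth≤ : lookup (nodeDepths gs) index ≤ d

open Node

-- The vectors of values and depths grow at the head only, so an old node survives with a shifted
-- index.
weaken : {gs : Gates n s} {gs′ : Gates n s′} {h : Vec Bool n → Bool} →
  gs ⊑[ d ] gs′ → Node gs d h → Node gs′ d h
weaken done       v = v
weaken (snoc p _) v = record
  { index = suc (index v′) ; value = value v′ ; depth≤ = depth≤ v′ }
  where v′ = weaken p v

record Extension (gs : Gates n s) (d N : ℕ)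
                 (P : ∀ {s′} → Gates n s′ → Set) : Set where
  field
    {count} : ℕ
    {gates} : Gates n count
    extends : gs ⊑[ d ] gates
    count≤  : count ≤ N + s
    result  : P gates

nodes-depth : {gs : Gates n s} {h : Fin k → Vec Bool n → Bool} →
  (v : ∀ i → Node gs d (h i)) →
  max 0 (List.map (lookup (nodeDepths gs)) (List.tabulate (index ∘ v))) ≤ d
nodes-depth {d = d} {gs = gs} v = max≤v⁺ z≤n
  (subst (λ xs → List.All (_≤ d) xs)
    (sym (map-tabulate (index ∘ v) (lookup (nodeDepths gs))))
    (List.tabulate⁺ (depth≤ ∘ v)))

-- Each construction is run on top of the result of the previous one, hence the quantification over
-- the base circuit. Nothing is shared, so the costs add up.
append : {h : Fin k → Vec Bool n → Bool} →
  (∀ i {s} (gs : Gates n s) → Extension gs d N (λ gs′ → Node gs′ d (h i))) →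
  (gs : Gates n s) → Extension gs d (k * N) (λ gs′ → ∀ i → Node gs′ d (h i))
append {k = zero} ext gs = record
  { extends = done ; count≤ = ≤-refl ; result = λ () }
append {k = suc k} {N = N} {s = s} ext gs = record
  { extends = ⊑-trans E.extends F.extends
  ; count≤  = begin
      F.count            ≤⟨ F.count≤ ⟩
      k * N + E.count    ≤⟨ +-monoʳ-≤ (k * N) E.count≤ ⟩
      k * N + (N + s)    ≡⟨ +-assoc (k * N) N s ⟨
      k * N + N + s      ≡⟨ cong (_+ s) (+-comm (k * N) N) ⟩
      N + k * N + s      ∎
  ; result  = λ { zero → weaken F.extends E.result ; (suc i) → F.result i }
  }
  where
  open ≤-Reasoning
  module E = Extension (ext zero gs)
  module F = Extension (append (ext ∘ suc) E.gates)

-- Of the 2 + w copies of `(2 + w) ^ d`, one pays for the top gate and the other 1 + w for the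
-- subformulas. A base of at least 2 lets negation fit the same bound even for w = 0.
gates-bound : ∀ d → k ≤ w → suc (k * (2 + w) ^ d) ≤ (2 + w) ^ suc d
gates-bound {k} {w} d k≤w = +-mono-≤ (m^n>0 (2 + w) d)
  (*-monoˡ-≤ ((2 + w) ^ d) (m≤n⇒m≤1+n k≤w))

count-suc : ∀ {a b c} s → suc a ≤ b → c ≤ a + s → suc c ≤ b + s
count-suc s a<b c≤a+s = ≤-trans (s≤s c≤a+s) (+-monoˡ-≤ s a<b)

compile : (f : Formula n w d) (gs : Gates n s) →
  Extension gs d ((2 + w) ^ d) (λ gs′ → Node gs′ d ⟦ f ⟧)
compile {n = n} {s = s} (var i) gs = record
  { extends = done
  ; count≤  = m≤n+m s _
  ; result  = input gs
  }
  where
  -- Inputs have the last indices, so the index shifts once per gate already present.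
  input : ∀ {d s} (gs : Gates n s) → Node gs d (λ x → lookup x i)
  input []       = record
    { index  = i
    ; value  = λ _ → refl
    ; depth≤ = ≤-trans (≤-reflexive (lookup-replicate i 0)) z≤n
    }
  input (gs ▷ _) = record
    { index = suc (index v) ; value = value v ; depth≤ = depth≤ v }
    where v = input gs
compile {w = w} {d = suc d} {s = s} (lift f) gs = record
  { extends = ⊑-suc E.extends
  ; count≤  = ≤-trans E.count≤ (+-monoˡ-≤ s (m≤n*m ((2 + w) ^ d) (2 + w)))
  ; result  = record
    { index = index E.result
    ; value = value E.result
    ; depth≤ = m≤n⇒m≤1+n (depth≤ E.result)
    }
  }
  where module E = Extension (compile f gs)
compile {w = w} {d = suc d} {s = s} (neg f) gs = record
  { gates   = E.gates ▷ Not (index E.result)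
  ; extends = snoc (⊑-suc E.extends) deep
  ; count≤  = count-suc s bound E.count≤
  ; result  = record
    { index = zero ; value = λ x → cong not (value E.result x) ; depth≤ = deep }
  }
  where
  module E = Extension (compile f gs)
  deep = s≤s (depth≤ E.result)
  bound : suc ((2 + w) ^ d) ≤ (2 + w) ^ suc d
  bound = +-mono-≤ (m^n>0 (2 + w) d) (m≤m+n ((2 + w) ^ d) _)
compile {d = suc d} {s = s} (and k≤w fs) gs = record
  { gates   = E.gates ▷ And (List.tabulate (index ∘ E.result))
  ; extends = snoc (⊑-suc E.extends) deep
  ; count≤  = count-suc s (gates-bound d k≤w) E.count≤
  ; result  = record
    { index  = zero
    ; value  = λ x → trans (all-tabulate _ (index ∘ E.result))
                           (⋀-cong λ i → value (E.result i) x)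
    ; depth≤ = deep
    }
  }
  where
  module E = Extension (append (λ i → compile (fs i)) gs)
  deep = s≤s (nodes-depth E.result)
compile {d = suc d} {s = s} (or k≤w fs) gs = record
  { gates   = E.gates ▷ Or (List.tabulate (index ∘ E.result))
  ; extends = snoc (⊑-suc E.extends) deep
  ; count≤  = count-suc s (gates-bound d k≤w) E.count≤
  ; result  = record
    { index  = zero
    ; value  = λ x → trans (any-tabulate _ (index ∘ E.result))
                           (⋁-cong λ i → value (E.result i) x)
    ; depth≤ = deep
    }
  }
  where
  module E = Extension (append (λ i → compile (fs i)) gs)
  deep = s≤s (nodes-depth E.result)

-- Polynomial bounds

^-distribʳ-* : ∀ m n k → (m * n) ^ k ≡ m ^ k * n ^ k
^-distribʳ-* m n zero    = refl
^-distribʳ-* m n (suc k) = trans (cong (m * n *_) (^-distribʳ-* m n k))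
  ([m*n]*[o*p]≡[m*o]*[n*p] m n (m ^ k) (n ^ k))

-- This is the shape demanded by `polySize`. For positive n, m + n is at most (1 + m)n; the additive
-- constant takes care of n = 0.
[m+n]^k≤ : ∀ m n k → (m + n) ^ k ≤ suc m ^ k * n ^ k + suc m ^ k
[m+n]^k≤ m zero    k = ≤-trans
  (^-monoˡ-≤ k (≤-trans (≤-reflexive (+-identityʳ m)) (n≤1+n m)))
  (m≤n+m (suc m ^ k) _)
[m+n]^k≤ m (suc n) k = begin
  (m + suc n) ^ k            ≤⟨ ^-monoˡ-≤ k (≤-trans (≤-reflexive (+-comm m (suc n)))
                                  (+-monoʳ-≤ (suc n) (m≤m*n m (suc n)))) ⟩
  (suc m * suc n) ^ k        ≡⟨ ^-distribʳ-* (suc m) (suc n) k ⟩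
  suc m ^ k * suc n ^ k      ≤⟨ m≤m+n _ (suc m ^ k) ⟩
  suc m ^ k * suc n ^ k + suc m ^ k ∎
  where open ≤-Reasoning

-- With q = 4 + m, the three summands total at most 5 times the power 1 + d of q, and 5 ≤ q² absorbs
-- the factor.
size-bound : ∀ d m {o c} → o ≤ 2 * (4 + m) → c ≤ o * (4 + m) ^ d →
  m + c + o ≤ (4 + m) ^ (3 + d)
size-bound d m {o} {c} o≤2q c≤o*p = begin
  m + c + o                          ≤⟨ +-mono-≤ (+-mono-≤ m≤q*p c≤2q*p) o≤2q*p ⟩
  q * p + 2 * q * p + 2 * q * p      ≡⟨ five q p ⟩
  5 * (q * p)                        ≤⟨ *-monoˡ-≤ (q * p) 5≤q*q ⟩
  q * q * (q * p)                    ≡⟨ *-assoc q q (q * p) ⟩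
  q ^ (3 + d)                        ∎
  where
  open ≤-Reasoning
  q = 4 + m
  p = q ^ d
  m≤m*p : ∀ m → m ≤ m * p
  m≤m*p m = m≤m*n m p {{m^n≢0 q d}}
  m≤q*p : m ≤ q * p
  m≤q*p = ≤-trans (m≤n+m m 4) (m≤m*p q)
  o≤2q*p : o ≤ 2 * q * p
  o≤2q*p = ≤-trans o≤2q (m≤m*p (2 * q))
  c≤2q*p : c ≤ 2 * q * p
  c≤2q*p = ≤-trans c≤o*p (*-monoˡ-≤ p o≤2q)
  five : ∀ q p → q * p + 2 * q * p + 2 * q * p ≡ 5 * (q * p)
  five = solve-∀
  5≤q*q : 5 ≤ q * q
  5≤q*q = ≤-trans (m≤m+n 5 11) (*-mono-≤ (m≤m+n 4 m) (m≤m+n 4 m))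

-- Circuits for vectors of formulas

module _ (fs : Vec (Formula n w d) k) where

  private
    module E = Extension (append (λ i → compile (lookup fs i)) [])

  toCircuit : Circuit n k
  toCircuit = record
    { gates = E.gates ; outputs = tabulate (index ∘ E.result) }

  toCircuit-eval : ∀ x → eval toCircuit x ≡ map (λ f → ⟦ f ⟧ x) fs
  toCircuit-eval x = begin
    map (lookup ρ) (tabulate (index ∘ E.result))  ≡⟨ tabulate-∘ (lookup ρ) _ ⟨
    tabulate (lookup ρ ∘ index ∘ E.result)        ≡⟨ tabulate-cong (λ i → value (E.result i) x) ⟩
    tabulate (λ i → ⟦ lookup fs i ⟧ x)            ≡⟨ tabulate-∘ (λ f → ⟦ f ⟧ x) (lookup fs) ⟩
    map (λ f → ⟦ f ⟧ x) (tabulate (lookup fs))    ≡⟨ cong (map _) (tabulate∘lookup fs) ⟩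
    map (λ f → ⟦ f ⟧ x) fs                        ∎
    where
    open ≡-Reasoning
    ρ = evalGates E.gates x

  toCircuit-depth : depth toCircuit ≤ d
  toCircuit-depth = max≤v⁺ {xs = toList (nodeDepths E.gates)} z≤n (toList⁺ (lookup⁻ (⊑-depths E.extends)))

  toCircuit-gateCount : Circuit.gateCount toCircuit ≤ k * (2 + w) ^ d
  toCircuit-gateCount = ≤-trans E.count≤ (≤-reflexive (+-identityʳ _))

-- Compact digits from carries

bitAt : Vec Bool m → ℕ → Bool
-- Padding with zeros: the digit at position m reads the bits at m and m + 1.
bitAt []       _       = false
bitAt (b ∷ _)  zero    = b
bitAt (_ ∷ bs) (suc i) = bitAt bs i

bitAt-fromℕ< : ∀ (x : Vec Bool m) {i} (i<m : i < m) → lookup x (fromℕ< i<m) ≡ bitAt x i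
bitAt-fromℕ< (b ∷ bs) {zero}  _   = refl
bitAt-fromℕ< (b ∷ bs) {suc i} i<m = bitAt-fromℕ< bs (s≤s⁻¹ i<m)

bitAt-≥ : ∀ (x : Vec Bool m) {i} → m ≤ i → bitAt x i ≡ false
bitAt-≥ []       _         = refl
bitAt-≥ (b ∷ bs) (s≤s m≤i) = bitAt-≥ bs m≤i

-- Majority in generate/propagate form, ready for carry lookahead.
nextCarry : (a a′ c : Bool) → Bool
nextCarry a a′ c = (a ∧ a′) ∨ ((a ∨ a′) ∧ c)

-- These are the carries in the schoolbook addition of A and ⌊A/2⌋.
carry : (ℕ → Bool) → ℕ → Bool
carry a zero    = false
carry a (suc i) = nextCarry (a i) (a (suc i)) (carry a i)

-- If a + c = 1, the next carry is a′ and the digit is 1 - 2a′. Otherwise the next carry equals both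
-- a and c, and the digit vanishes.
digit : (c a a′ : Bool) → Digit
digit c a a′ = if c xor a then (if a′ then minusOne else plusOne) else nought

digitAt : (ℕ → Bool) → ℕ → Digit
digitAt a i = digit (carry a i) (a i) (a (suc i))

digit-compact : ∀ c a a′ a″ →
  digit→ℤ (digit (nextCarry a a′ c) a′ a″) ℤ.* digit→ℤ (digit c a a′) ≡ 0ℤ
digit-compact false false a′    a″    = ℤ.*-zeroʳ (digit→ℤ (digit (nextCarry false a′ false) a′ a″))
digit-compact true  true  a′    a″    = ℤ.*-zeroʳ (digit→ℤ (digit (nextCarry true a′ true) a′ a″))
-- From here on the next carry equals `a′`, so the upper digit is `nought` whatever `a″` is.
digit-compact false true  false a″    = refl
digit-compact false true  true  a″    = refl
digit-compact true  false false a″    = refl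
digit-compact true  false true  a″    = refl

digit-value : ∀ c a a′ → digit→ℤ (digit c a a′) ≡
  bit→ℤ a ℤ.+ (bit→ℤ c ℤ.- (+ 2) ℤ.* bit→ℤ (nextCarry a a′ c))
digit-value false false false = refl
digit-value false false true  = refl
digit-value false true  false = refl
digit-value false true  true  = refl
digit-value true  false false = refl
digit-value true  false true  = refl
digit-value true  true  false = refl
digit-value true  true  true  = refl

sum-telescope : ∀ k (u : ℕ → ℤ) →
  sum {k} (λ i → u (toℕ i) ℤ.- u (suc (toℕ i))) ≡ u 0 ℤ.- u k
sum-telescope zero    u = sym (ℤ.+-inverseʳ (u 0))
sum-telescope (suc k) u = begin
  (u 0 ℤ.- u 1) ℤ.+ sum {k} (λ i → u (suc (toℕ i)) ℤ.- u (suc (suc (toℕ i))))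
    ≡⟨ cong (ℤ._+_ (u 0 ℤ.- u 1)) (sum-telescope k (u ∘ suc)) ⟩
  (u 0 ℤ.- u 1) ℤ.+ (u 1 ℤ.- u (suc k))  ≡⟨ collapse (u 0) (u 1) (u (suc k)) ⟩
  u 0 ℤ.- u (suc k)                      ∎
  where
  open ≡-Reasoning
  collapse : ∀ x y z → (x ℤ.- y) ℤ.+ (y ℤ.- z) ≡ x ℤ.- z
  collapse = ℤ.solve-∀

-- The additional top position holds a padding zero. The weight is arbitrary so that the induction
-- can shift it.
sum-bits : ∀ (x : Vec Bool m) (wt : ℕ → ℤ) →
  sum {suc m} (λ i → bit→ℤ (bitAt x (toℕ i)) ℤ.* wt (toℕ i)) ≡
  sum (λ i → lookup (map bit→ℤ x) i ℤ.* wt (toℕ i))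
sum-bits []       wt = refl
sum-bits (b ∷ bs) wt = cong (ℤ._+_ (bit→ℤ b ℤ.* wt 0)) (sum-bits bs (wt ∘ suc))

-- The extra digit is needed: 3 = 4 - 1 has no compact representation of length 2.
digits : ∀ m → Vec Bool m → Vec Digit (suc m)
digits m x = tabulate (digitAt (bitAt x) ∘ toℕ)

digits-compact : ∀ (x : Vec Bool m) → Compact (digits m x)
digits-compact {m} x i j i≡1+j
  rewrite lookup∘tabulate (digitAt (bitAt x) ∘ toℕ) i
        | lookup∘tabulate (digitAt (bitAt x) ∘ toℕ) j
        | i≡1+j
  = digit-compact (carry a (toℕ j)) (a (toℕ j)) (a (suc (toℕ j))) (a (suc (suc (toℕ j))))
  where a = bitAt x

-- Two of the three bits in this majority are padding zeros. Hence m + 1 digits suffice.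
carry-final : ∀ (x : Vec Bool m) → carry (bitAt x) (suc m) ≡ false
carry-final {m} x
  rewrite bitAt-≥ x (≤-refl {m}) | bitAt-≥ x (n≤1+n m) = refl

digits-val : ∀ (x : Vec Bool m) → val (digits m x) ≡ binaryValue x
digits-val {m} x = begin
  val (digits m x)
    ≡⟨ sum-cong-≗ {suc m} split ⟩
  sum {suc m} (λ i → bit (toℕ i) ℤ.+ (u (toℕ i) ℤ.- u (suc (toℕ i))))
    ≡⟨ ∑-distrib-+ {suc m} (bit ∘ toℕ) (λ i → u (toℕ i) ℤ.- u (suc (toℕ i))) ⟩
  sum {suc m} (bit ∘ toℕ) ℤ.+ sum {suc m} (λ i → u (toℕ i) ℤ.- u (suc (toℕ i)))
    -- `u 0` reduces to `0ℤ`, since the initial carry is `false`.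
    ≡⟨ cong₂ ℤ._+_ (sum-bits x ((+ 2) ℤ.^_)) (sum-telescope (suc m) u) ⟩
  binaryValue x ℤ.+ (0ℤ ℤ.- u (suc m))
    ≡⟨ cong (λ c → binaryValue x ℤ.+ (0ℤ ℤ.- bit→ℤ c ℤ.* (+ 2) ℤ.^ suc m)) (carry-final x) ⟩
  binaryValue x ℤ.+ 0ℤ
    ≡⟨ ℤ.+-identityʳ _ ⟩
  binaryValue x ∎
  where
  open ≡-Reasoning
  a = bitAt x
  bit u : ℕ → ℤ
  bit i = bit→ℤ (a i) ℤ.* (+ 2) ℤ.^ i
  u i = bit→ℤ (carry a i) ℤ.* (+ 2) ℤ.^ i
  distribute : ∀ a c c′ p →
    (a ℤ.+ (c ℤ.- (+ 2) ℤ.* c′)) ℤ.* p ≡ a ℤ.* p ℤ.+ (c ℤ.* p ℤ.- c′ ℤ.* ((+ 2) ℤ.* p))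
  distribute = ℤ.solve-∀
  split : ∀ i → lookup (map digit→ℤ (digits m x)) i ℤ.* (+ 2) ℤ.^ toℕ i ≡
    bit (toℕ i) ℤ.+ (u (toℕ i) ℤ.- u (suc (toℕ i)))
  split i = trans
    (cong (ℤ._* (+ 2) ℤ.^ toℕ i)
      (trans (lookup-map i digit→ℤ (digits m x))
        (trans (cong digit→ℤ (lookup∘tabulate (digitAt a ∘ toℕ) i))
               (digit-value (carry a (toℕ i)) (a (toℕ i)) (a (suc (toℕ i)))))))
    (distribute (bit→ℤ (a (toℕ i))) (bit→ℤ (carry a (toℕ i)))
                (bit→ℤ (carry a (suc (toℕ i)))) ((+ 2) ℤ.^ toℕ i))

-- The recurrence cᵢ₊₁ = gᵢ ∨ (pᵢ ∧ cᵢ), with gᵢ = aᵢ ∧ aᵢ₊₁ and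
-- pᵢ = aᵢ ∨ aᵢ₊₁, unrolled.  Indices run downwards from i − 1, so that the
-- unrolling at i + 1 begins with the last step; no subtraction truncates.
lookahead : (ℕ → Bool) → ℕ → Bool
lookahead a i = ⋁ {i} λ j →
  (a (i ∸ suc (toℕ j)) ∧ a (suc (i ∸ suc (toℕ j)))) ∧
  ⋀ {toℕ j} λ k → a (i ∸ suc (toℕ k)) ∨ a (suc (i ∸ suc (toℕ k)))

-- The disjunct for j = 0 has an empty conjunction of propagates and is gᵢ. All later disjuncts
-- contain pᵢ; factoring it out leaves the unrolling at i.
lookahead≡carry : ∀ a i → lookahead a i ≡ carry a i
lookahead≡carry a zero    = refl
lookahead≡carry a (suc i) = cong₂ _∨_ (∧-identityʳ _) (begin
  (⋁ {i} λ j → g j ∧ (p ∧ q j))    ≡⟨ ⋁-cong {i} (λ j → swap (g j) p (q j)) ⟩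
  (⋁ {i} λ j → p ∧ (g j ∧ q j))    ≡⟨ ∧-distribˡ-⋁ {i} p _ ⟨
  p ∧ lookahead a i                ≡⟨ cong (p ∧_) (lookahead≡carry a i) ⟩
  p ∧ carry a i                    ∎)
  where
  open ≡-Reasoning
  p = a i ∨ a (suc i)
  g q : Fin i → Bool
  g j = a (i ∸ suc (toℕ j)) ∧ a (suc (i ∸ suc (toℕ j)))
  q j = ⋀ {toℕ j} λ k → a (i ∸ suc (toℕ k)) ∨ a (suc (i ∸ suc (toℕ k)))
  swap : ∀ x y z → x ∧ (y ∧ z) ≡ y ∧ (x ∧ z)
  swap x y z = trans (sym (∧-assoc x y z))
    (trans (cong (_∧ z) (∧-comm x y)) (∧-assoc y x z))

-- Formulas for carries and digits

and₂ or₂ : 2 ≤ w → Formula n w d → Formula n w d → Formula n w (suc d)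
and₂ 2≤w f g = and 2≤w λ { zero → f ; (suc _) → g }
or₂  2≤w f g = or  2≤w λ { zero → f ; (suc _) → g }

constF : Bool → Formula n w (suc d)
constF true  = and z≤n λ ()
constF false = or z≤n λ ()

constF-⟦⟧ : ∀ b (x : Vec Bool n) → ⟦ constF {w = w} {d = d} b ⟧ x ≡ b
constF-⟦⟧ true  x = refl
constF-⟦⟧ false x = refl

-- A multiplexer. Since `t` is a function on `Bool`, nested branches realise any function of
-- finitely many bits as a decision tree. `lift` puts `f` at the depth of `neg f`.
branch : 2 ≤ w → Formula n w d → (Bool → Formula n w (suc d)) → Formula n w (3 + d)
branch 2≤w f t = or₂ 2≤w (and₂ 2≤w (lift f) (t true)) (and₂ 2≤w (neg f) (t false))

branch-⟦⟧ : ∀ (2≤w : 2 ≤ w) (f : Formula n w d) t x {b r} →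
  ⟦ f ⟧ x ≡ b → ⟦ t b ⟧ x ≡ r → ⟦ branch 2≤w f t ⟧ x ≡ r
branch-⟦⟧ 2≤w f t x refl t≡r with ⟦ f ⟧ x
... | true  = trans (∨-identityʳ _) (trans (∧-identityʳ _) t≡r)
... | false = trans (∨-identityʳ _) (trans (∧-identityʳ _) t≡r)

bitF : ℕ → Formula n w (suc d)
bitF {n} i with i <? n
... | yes i<n = var (fromℕ< i<n)
... | no  _   = constF false

bitF-⟦⟧ : ∀ i (x : Vec Bool n) → ⟦ bitF {w = w} {d = d} i ⟧ x ≡ bitAt x i
bitF-⟦⟧ {n} i x with i <? n
... | yes i<n = bitAt-fromℕ< x i<n
... | no  i≮n = sym (bitAt-≥ x (≮⇒≥ i≮n))

module _ (2≤w : 2 ≤ w) where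

  carryF : ∀ i → i ≤ w → Formula n w 4
  -- Each conjunction has 1 + j operands, one generate and j propagates, and 1 + j ≤ i ≤ w.
  carryF i i≤w = or i≤w λ j → and (≤-trans (toℕ<n j) i≤w) λ
    { zero    → and₂ 2≤w (bitF (i ∸ suc (toℕ j))) (bitF (suc (i ∸ suc (toℕ j))))
    ; (suc k) → or₂ 2≤w (bitF (i ∸ suc (toℕ k))) (bitF (suc (i ∸ suc (toℕ k))))
    }

  carryF-⟦⟧ : ∀ i i≤w (x : Vec Bool n) → ⟦ carryF i i≤w ⟧ x ≡ carry (bitAt x) i
  carryF-⟦⟧ i i≤w x = trans
    (⋁-cong {i} λ j → cong₂ _∧_
      (cong₂ _∧_ (bitF-⟦⟧ (i ∸ suc (toℕ j)) x)
        (trans (∧-identityʳ _) (bitF-⟦⟧ (suc (i ∸ suc (toℕ j))) x)))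
      (⋀-cong {toℕ j} λ k → cong₂ _∨_ (bitF-⟦⟧ (i ∸ suc (toℕ k)) x)
        (trans (∨-identityʳ _) (bitF-⟦⟧ (suc (i ∸ suc (toℕ k))) x))))
    (lookahead≡carry (bitAt x) i)

  module _ (h : Digit → Bool) (i : ℕ) where

    onNext : (c a : Bool) → Formula n w 4
    onNext c a = branch 2≤w (bitF (suc i)) λ a′ → constF (h (digit c a a′))

    onBit : (c : Bool) → Formula n w 6
    onBit c = branch 2≤w (bitF i) (onNext c)

    -- A decision tree on cᵢ, aᵢ and aᵢ₊₁. Each `branch` lies two levels above its alternatives, so
    -- the depths are 4, 6 and 8; the carry is lifted to depth 5 to fit the outermost one.
    digitF : i ≤ w → Formula n w 8
    digitF i≤w = branch 2≤w (lift (carryF i i≤w)) onBit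

    digitF-⟦⟧ : ∀ i≤w (x : Vec Bool n) →
      ⟦ digitF i≤w ⟧ x ≡ h (digitAt (bitAt x) i)
    digitF-⟦⟧ i≤w x =
      branch-⟦⟧ 2≤w (lift (carryF i i≤w)) onBit x (carryF-⟦⟧ i i≤w x)
        (branch-⟦⟧ 2≤w (bitF i) (onNext c) x (bitF-⟦⟧ i x)
          (branch-⟦⟧ 2≤w (bitF (suc i)) (λ a′ → constF (h (digit c a a′))) x
            (bitF-⟦⟧ (suc i) x) (constF-⟦⟧ (h (digit c a a′)) x)))
      where
      c = carry (bitAt x) i
      a = bitAt x i
      a′ = bitAt x (suc i)

-- Membership in AC⁰

InAC⁰-digits : ∀ e → InAC⁰ (λ m x → encode e (digits m x))
InAC⁰-digits e = record
  { circuit       = λ m → toCircuit (formulas m)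
  ; computes      = λ m x → trans (toCircuit-eval (formulas m) x) (correct m x)
  ; constantDepth = 8 , λ m → toCircuit-depth (formulas m)
  -- The exponent is 3 + 8, for formulas of depth 8, and 5 is 1 + 4 from bounding the powers of 4 +
  -- m.
  ; polySize      = 5 ^ 11 , 11 , λ m → ≤-trans
      (size-bound 8 m (outputs≤ m) (toCircuit-gateCount (formulas m)))
      ([m+n]^k≤ 4 m 11)
  }
  where
  open DigitEncoding e
  -- Fan-in 2 + m admits binary gates even for m = 0, and every position up to m. It makes the base
  -- of the gate count 4 + m.
  i≤2+m : ∀ {m} (i : Fin (suc m)) → toℕ i ≤ 2 + m
  i≤2+m i = m≤n⇒m≤1+n (<⇒≤ (toℕ<n i))

  codeBit : ∀ m → Fin (suc m) → Fin 2 → Formula m (2 + m) 8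
  codeBit m i j =
    digitF (m≤m+n 2 m) (λ z → lookup (code z) j) (toℕ i) (i≤2+m i)

  block : ∀ m → Fin (suc m) → Vec (Formula m (2 + m) 8) 2
  block m i = tabulate (codeBit m i)

  formulas : ∀ m → Vec (Formula m (2 + m) 8) (suc m * 2)
  formulas m = concat (tabulate (block m))

  block-⟦⟧ : ∀ m x i →
    map (λ f → ⟦ f ⟧ x) (block m i) ≡ code (digitAt (bitAt x) (toℕ i))
  block-⟦⟧ m x i = trans (sym (tabulate-∘ (λ f → ⟦ f ⟧ x) (codeBit m i))) (trans
    (tabulate-cong λ j → digitF-⟦⟧ (m≤m+n 2 m) (λ z → lookup (code z) j) (toℕ i) (i≤2+m i) x)
    (tabulate∘lookup _))

  correct : ∀ m x → map (λ f → ⟦ f ⟧ x) (formulas m) ≡ encode e (digits m x)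
  correct m x = trans (map-concat _ (tabulate (block m))) (cong concat (begin
    map (map _) (tabulate (block m))                        ≡⟨ tabulate-∘ (map _) (block m) ⟨
    tabulate (map (λ f → ⟦ f ⟧ x) ∘ block m)                ≡⟨ tabulate-cong (block-⟦⟧ m x) ⟩
    tabulate (λ i → code (digitAt (bitAt x) (toℕ i)))       ≡⟨ tabulate-∘ code (digitAt (bitAt x) ∘ toℕ) ⟩
    map code (digits m x)                                   ∎))
    where open ≡-Reasoning

  outputs≤ : ∀ m → suc m * 2 ≤ 2 * (4 + m)
  outputs≤ m = ≤-trans (*-monoˡ-≤ 2 (s≤s (m≤n+m m 3))) (≤-reflexive (*-comm (4 + m) 2))

theorem12 : (e : DigitEncoding) →
    Σ[ ℓ ∈ (ℕ → ℕ) ] Σ[ B ∈ ((m : ℕ) → Vec Bool m → Vec Digit (ℓ m)) ]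
    ((m : ℕ) (a : Vec Bool m) → Compact (B m a) × val (B m a) ≡ binaryValue a)
    × InAC⁰ (λ m a → encode e (B m a))
theorem12 e = suc , digits , (λ m a → digits-compact a , digits-val a) , InAC⁰-digits e
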